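{- Let $\mathfrak{S}\subset\mathbb{Z}^2$ be a set of steps that is well-ordered in the reverse lexicographic ordering. Let $p$ be the smallest positive integer such that there is an $\mathfrak{S}$-path (starting at $(0,0)$) ending at $(p,0)$. Then for every $n\ge1$, the number of walks on the half plane avoiding the half line that have steps in $\mathfrak S$, end at $(p,0)$ and have length $n$ equals $\frac1n$ times the number of $\mathfrak{S}$-paths that end at $(p,0)$ and have length $n$.
   Context: Reverse lexicographic ordering on $\mathbb{Z}^2$: $(a,b)<(c,d)$ iff $b<d$, or $b=d$ and $a<c$. An $\mathfrak{S}$-path of length $n$ is a sequence of $n$ steps $s_1,\dots,s_n\in\mathfrak{S}$, viewed as the lattice path in $\mathbb{Z}^2$ starting at $(0,0)$ and visiting the partial sums $s_1+\dots+s_i$; well-orderedness of $\mathfrak S$ guarantees that the number of paths of given length and endpoint is finite. A walk on the half plane avoiding the half line is an $\mathfrak{S}$-path that never visits a point $(i,j)$ with $j<0$ and, after its starting point, never visits a point of $\{(-k,0):k\ge0\}$. -}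

module Defs where

open import Data.Fin using (Fin; zero; suc; fromℕ)
open import Data.Integer using (ℤ; +_; 0ℤ; _+_; -_; _<_; _≤_)
open import Data.List using (List; length)
import Data.List.Membership.Propositional as List
open import Data.List.Relation.Unary.Unique.Propositional using (Unique)
open import Data.Nat using (ℕ; suc)
open import Data.Product using (∃; ∃-syntax; _×_; _,_; proj₁; proj₂; swap; zip)
open import Data.Product.Relation.Binary.Lex.Strict using (×-Lex)
open import Data.Vec using (Vec; []; _∷_)
open import Data.Vec.Relation.Unary.All using (All)
open import Function using (_on_; _⇔_)
open import Level using (0ℓ)
open import Relation.Binary using (Rel)
import Relation.Binary.Construct.StrictToNonStrict as ToNonStrict
open import Relation.Binary.PropositionalEquality using (_≡_)
open import Relation.Nullary using (¬_)
open import Relation.Unary using (Pred; _∈_; _⊆_; Satisfiable)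

ℤ² : Set
ℤ² = ℤ × ℤ

origin : ℤ²
origin = 0ℤ , 0ℤ

infixl 6 _⊕_

_⊕_ : ℤ² → ℤ² → ℤ²
_⊕_ = zip _+_ _+_

infix 4 _<ʳ_ _≤ʳ_

-- Reverse lexicographic order: after swapping, second coordinates are
-- compared first, and ties are broken by the first coordinates.
_<ʳ_ : Rel ℤ² 0ℓ
_<ʳ_ = ×-Lex _≡_ _<_ _<_ on swap

_≤ʳ_ : Rel ℤ² 0ℓ
_≤ʳ_ = ToNonStrict._≤_ _≡_ _<ʳ_

-- The classical formulation (every nonempty subset has a least element) is
-- used rather than accessibility: accessibility alone does not constructively
-- yield the finiteness of the sets of paths being counted.
WellOrdered : Pred ℤ² 0ℓ → Set₁
WellOrdered S = (A : Pred ℤ² 0ℓ) → A ⊆ S → Satisfiable A →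
  ∃[ x ] (x ∈ A × (∀ y → y ∈ A → x ≤ʳ y))

-- The lattice point s₁ + … + sᵢ reached after i steps, for 0 ≤ i ≤ n.
point : ∀ {n} → Vec ℤ² n → Fin (suc n) → ℤ²
point _        zero    = origin
point (s ∷ ss) (suc i) = s ⊕ point ss i

endpoint : ∀ {n} → Vec ℤ² n → ℤ²
endpoint {n} ss = point ss (fromℕ n)

PathTo : Pred ℤ² 0ℓ → (n : ℕ) → ℤ² → Pred (Vec ℤ² n) 0ℓ
PathTo S n z ss = All S ss × endpoint ss ≡ z

HalfLine : Pred ℤ² 0ℓ
HalfLine z = ∃[ k ] z ≡ (- (+ k) , 0ℤ)

-- The second condition omits only the starting point (time 0); returning to
-- the origin at a later time is forbidden.
Avoiding : ∀ {n} → Pred (Vec ℤ² n) 0ℓ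
Avoiding {n} ss =
  ((i : Fin (suc n)) → ¬ (proj₂ (point ss i) < 0ℤ)) ×
  ((i : Fin n) → ¬ (point ss (suc i) ∈ HalfLine))

WalkTo : Pred ℤ² 0ℓ → (n : ℕ) → ℤ² → Pred (Vec ℤ² n) 0ℓ
WalkTo S n z ss = PathTo S n z ss × Avoiding ss

ReachesAxisAt : Pred ℤ² 0ℓ → Pred ℤ 0ℓ
ReachesAxisAt S q = ∃[ n ] ∃[ ss ] PathTo S n (q , 0ℤ) ss

IsSmallestPositive : Pred ℤ 0ℓ → Pred ℤ 0ℓ
IsSmallestPositive Q p =
  0ℤ < p × p ∈ Q × (∀ q → 0ℤ < q → q ∈ Q → p ≤ q)

-- P has exactly m elements, counted up to propositional equality of the
-- underlying x (so the choice of proof of P x does not matter).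
HasCardinality : {A : Set} → Pred A 0ℓ → ℕ → Set
HasCardinality {A} P m =
  ∃[ xs ] (Unique xs × (∀ (x : A) → x List.∈ xs ⇔ P x) × length xs ≡ m)

{-# OPTIONS --safe #-}

-- The points (x , y) > (0 , 0) in the reverse lexicographic order form a
-- positive cone, and the walks to be counted are exactly the paths all of whose
-- points after the start are positive.  Cutting an arbitrary path to (p , 0)
-- after its last minimal point and exchanging the two pieces gives such a walk.
-- If two rotations of a path are walks, the path is cut cyclically into two
-- pieces with positive displacements adding up to (p , 0); both then lie on the
-- axis and one of them ends strictly between 0 and p, contradicting the choice
-- of p.  So the paths are the rotations of the walks, each obtained once.
--
-- For finiteness, if the least step is positive it must be (p , 0), and the
-- only path is the one-step path.  Otherwise S has two distinct elements, and
-- then well-orderedness decides every proposition; well-orderedness moreover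
-- confines the steps of a path with given length and endpoint to a finite box.

module Submission where

open import Axiom.ExcludedMiddle using (ExcludedMiddle)
open import Data.Fin using (Fin; zero; suc)
open import Data.Integer using (ℤ; +_; -[1+_]; 0ℤ; _+_; _-_; -_; _<_; _≤_; ∣_∣; +<+)
import Data.Integer as ℤ
import Data.Integer.Properties as ℤ
open import Data.List as List
  using (List; []; _∷_; _++_; length; map; upTo
        ; cartesianProduct; cartesianProductWith; filter; deduplicate)
import Data.List.Properties as List
import Data.List.Membership.Propositional as List
open import Data.List.Membership.Propositional.Properties
  using (∈-map⁺; ∈-map⁻; ∈-upTo⁺; ∈-upTo⁻; ∈-cartesianProduct⁺; ∈-cartesianProduct⁻
        ; ∈-cartesianProductWith⁺; ∈-filter⁺; ∈-filter⁻; ∈-deduplicate⁺)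
open import Data.List.Relation.Unary.All as All using (All; []; _∷_)
import Data.List.Relation.Unary.All.Properties as All
open import Data.List.Relation.Unary.AllPairs using ([]; _∷_)
open import Data.List.Relation.Unary.Any using (here; there)
open import Data.List.Relation.Unary.Unique.Propositional using (Unique)
open import Data.List.Relation.Unary.Unique.DecPropositional.Properties using (deduplicate-!)
import Data.List.Relation.Unary.Unique.Propositional.Properties as Unique
open import Data.Nat as ℕ using (ℕ; zero; suc; NonZero; pred)
import Data.Nat.Properties as ℕ
open import Data.Product using (∃-syntax; _×_; _,_; proj₁; proj₂; swap)
open import Data.Product.Properties using (≡-dec)
import Data.Product.Relation.Binary.Lex.Strict as Lex
open import Data.Rational using (_/_; _*_; toℚᵘ)
import Data.Rational.Properties as ℚ
import Data.Rational.Unnormalised as ℚᵘ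
import Data.Rational.Unnormalised.Properties as ℚᵘ
open import Data.Sum using (_⊎_; inj₁; inj₂)
open import Data.Vec as Vec using (Vec; []; _∷_; _∷ʳ_; toList; fromList)
import Data.Vec.Properties as Vec
import Data.Vec.Relation.Unary.All.Properties as VecAll
open import Function using (_∘_; mk⇔; Equivalence)
open import Level using (0ℓ)
open import Relation.Binary using (Transitive; Decidable; tri<; tri≈; tri>)
open import Relation.Binary.PropositionalEquality
  using (_≡_; refl; sym; trans; cong; cong₂; subst; subst₂; isEquivalence; resp₂
        ; module ≡-Reasoning)
open import Relation.Nullary using (¬_; Dec; yes; no; contradiction)
open import Relation.Unary using (Pred; _∈_)
open import Defs

private
  variable
    A B : Set
    n : ℕ
    x y z w : ℤ²
    xs ys : List ℤ²
    S : Pred ℤ² 0ℓ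

-- The ordered group ℤ²

⊕-assoc : ∀ x y z → (x ⊕ y) ⊕ z ≡ x ⊕ (y ⊕ z)
⊕-assoc (a , b) (c , d) (e , f) = cong₂ _,_ (ℤ.+-assoc a c e) (ℤ.+-assoc b d f)

⊕-comm : ∀ x y → x ⊕ y ≡ y ⊕ x
⊕-comm (a , b) (c , d) = cong₂ _,_ (ℤ.+-comm a c) (ℤ.+-comm b d)

⊕-identityˡ : ∀ x → origin ⊕ x ≡ x
⊕-identityˡ (a , b) = cong₂ _,_ (ℤ.+-identityˡ a) (ℤ.+-identityˡ b)

⊕-identityʳ : ∀ x → x ⊕ origin ≡ x
⊕-identityʳ (a , b) = cong₂ _,_ (ℤ.+-identityʳ a) (ℤ.+-identityʳ b)

<ʳ-trans : Transitive _<ʳ_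
<ʳ-trans {x} {y} {z} =
  Lex.×-transitive {_<₂_ = _<_} isEquivalence (resp₂ _<_) ℤ.<-trans ℤ.<-trans
    {swap x} {swap y} {swap z}

<ʳ-irrefl : ¬ (x <ʳ x)
<ʳ-irrefl (inj₁ b<b)       = ℤ.<-irrefl refl b<b
<ʳ-irrefl (inj₂ (_ , a<a)) = ℤ.<-irrefl refl a<a

<ʳ-≤ʳ-trans : x <ʳ y → y ≤ʳ z → x <ʳ z
<ʳ-≤ʳ-trans x<y (inj₁ y<z)  = <ʳ-trans x<y y<z
<ʳ-≤ʳ-trans x<y (inj₂ refl) = x<y

≤ʳ-<ʳ-trans : x ≤ʳ y → y <ʳ z → x <ʳ z
≤ʳ-<ʳ-trans (inj₁ x<y)  y<z = <ʳ-trans x<y y<z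
≤ʳ-<ʳ-trans (inj₂ refl) y<z = y<z

≤ʳ-trans : x ≤ʳ y → y ≤ʳ z → x ≤ʳ z
≤ʳ-trans (inj₁ x<y)  y≤z = inj₁ (<ʳ-≤ʳ-trans x<y y≤z)
≤ʳ-trans (inj₂ refl) y≤z = y≤z

Positive : Pred ℤ² 0ℓ
Positive z = origin <ʳ z

positive? : ∀ z → Dec (Positive z)
positive? z = Lex.×-decidable ℤ._≟_ ℤ._<?_ ℤ._<?_ (0ℤ , 0ℤ) (proj₂ z , proj₁ z)

Positive⇒height≥0 : Positive z → 0ℤ ≤ proj₂ z
Positive⇒height≥0 (inj₁ 0<y)       = ℤ.<⇒≤ 0<y
Positive⇒height≥0 (inj₂ (0≡y , _)) = ℤ.≤-reflexive 0≡y

positive-on-axis : ∀ {a} → Positive (a , 0ℤ) → 0ℤ < a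
positive-on-axis (inj₁ 0<0)       = contradiction 0<0 (ℤ.<-irrefl refl)
positive-on-axis (inj₂ (_ , 0<a)) = 0<a

<ʳ-⊕ : ∀ x → Positive z → x <ʳ x ⊕ z
<ʳ-⊕ {c , d} (a , b) (inj₁ 0<d) =
  inj₁ (subst (λ u → u < b + d) (ℤ.+-identityʳ b) (ℤ.+-monoʳ-< b 0<d))
<ʳ-⊕ {c , d} (a , b) (inj₂ (refl , 0<c)) =
  inj₂ (sym (ℤ.+-identityʳ b) , subst (λ u → u < a + c) (ℤ.+-identityʳ a) (ℤ.+-monoʳ-< a 0<c))

Positive-⊕ : Positive x → Positive z → Positive (x ⊕ z)
Positive-⊕ {x} x>0 z>0 = <ʳ-trans x>0 (<ʳ-⊕ x z>0)

-- The order is total, so a non-positive `w` is at most `origin` and adding it to `z` cannot raise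
-- `z`. In the tie case the sign of the height of `w` decides.
Positive-cancelʳ : ¬ Positive w → Positive (z ⊕ w) → Positive z
Positive-cancelʳ {c , d} {a , b} w≯0 (inj₁ 0<b+d) =
  inj₁ (ℤ.<-≤-trans 0<b+d
    (subst (b + d ≤_) (ℤ.+-identityʳ b) (ℤ.+-monoʳ-≤ b (ℤ.≮⇒≥ (w≯0 ∘ inj₁)))))
Positive-cancelʳ {c , d} {a , b} w≯0 (inj₂ (0≡b+d , 0<a+c)) with ℤ.<-cmp d 0ℤ
... | tri< d<0 _ _ =
  inj₁ (subst₂ _<_ (sym 0≡b+d) (ℤ.+-identityʳ b) (ℤ.+-monoʳ-< b d<0))
... | tri≈ _ refl _ =
  inj₂ (trans 0≡b+d (ℤ.+-identityʳ b) , ℤ.<-≤-trans 0<a+c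
    (subst (a + c ≤_) (ℤ.+-identityʳ a) (ℤ.+-monoʳ-≤ a (ℤ.≮⇒≥ (w≯0 ∘ inj₂ ∘ (refl ,_))))))
... | tri> _ _ 0<d = contradiction (inj₁ 0<d) w≯0

-- Sums of steps and paths in the positive cone.

total : List ℤ² → ℤ²
total = List.foldr _⊕_ origin

total-++ : ∀ xs ys → total (xs ++ ys) ≡ total xs ⊕ total ys
total-++ []       ys = sym (⊕-identityˡ (total ys))
total-++ (x ∷ xs) ys = trans (cong (x ⊕_) (total-++ xs ys)) (sym (⊕-assoc x (total xs) (total ys)))

≤ʳ-⊕-total : All Positive xs → ∀ z → z ≤ʳ z ⊕ total xs
≤ʳ-⊕-total []                       z = inj₂ (sym (⊕-identityʳ z))
≤ʳ-⊕-total {x ∷ xs} (x>0 ∷ xs>0) z =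
  inj₁ (<ʳ-⊕ z (<ʳ-≤ʳ-trans x>0 (≤ʳ-⊕-total xs>0 x)))

-- The points of the path xs translated to start at z, except z itself, are
-- all positive.
data Above (z : ℤ²) : List ℤ² → Set where
  []  : Above z []
  _∷_ : Positive (z ⊕ x) → Above (z ⊕ x) xs → Above z (x ∷ xs)

Above-raise : Positive z → Above w xs → Above (z ⊕ w) xs
Above-raise z>0 []                                = []
Above-raise {z} {w} z>0 (_∷_ {x} w+x>0 w+x-above) =
  subst Positive (sym (⊕-assoc z w x)) (Positive-⊕ z>0 w+x>0) ∷
  subst (λ u → Above u _) (sym (⊕-assoc z w x)) (Above-raise z>0 w+x-above)

Above-++ : Above z xs → Above (z ⊕ total xs) ys → Above z (xs ++ ys)
Above-++ {z} []                   p = subst (λ u → Above u _) (⊕-identityʳ z) p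
Above-++ {z} (_∷_ {x} z+x>0 q) p =
  z+x>0 ∷ Above-++ q (subst (λ u → Above u _) (sym (⊕-assoc z x _)) p)

Above⇒Positive-total : ∀ xs → Above z (x ∷ xs ++ ys) → Positive (z ⊕ total (x ∷ xs))
Above⇒Positive-total {z} {x} []        (z+x>0 ∷ _) =
  subst (λ u → Positive (z ⊕ u)) (sym (⊕-identityʳ x)) z+x>0
Above⇒Positive-total {z} {x} (x′ ∷ xs) (_ ∷ p)     =
  subst Positive (⊕-assoc z x _) (Above⇒Positive-total xs p)

-- The second condition on the first piece says that its endpoint is a lowest
-- of its points.
cut-at-last-minimum : (x : ℤ²) (xs : List ℤ²) → ∃[ as ] ∃[ a ] ∃[ bs ]
  x List.∷ xs ≡ a List.∷ as ++ bs × Above origin bs ×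
  (∀ z → Positive (z ⊕ total (a ∷ as)) → Above z (a ∷ as))
cut-at-last-minimum x [] = [] , x , [] , refl , [] ,
  λ z p → subst (λ u → Positive (z ⊕ u)) (⊕-identityʳ x) p ∷ []
cut-at-last-minimum x (x′ ∷ xs) with cut-at-last-minimum x′ xs
... | as , a , bs , refl , bs-above , min with positive? (total (a ∷ as))
-- The lowest point of the tail lies above the end of `x`, hence so do all its points, and the last
-- minimum is the end of `x` itself.
...   | yes a>0 = [] , x , a ∷ as ++ bs , refl ,
  Above-++ (min origin (subst Positive (sym (⊕-identityˡ _)) a>0))
           (subst (λ u → Above u bs) (⊕-comm (total (a ∷ as)) origin) (Above-raise a>0 bs-above)) ,
  λ z p → subst (λ u → Positive (z ⊕ u)) (⊕-identityʳ x) p ∷ []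
-- The minimum of the tail is not above the end of `x`, so the cut stays. Cancelling the
-- non-positive total makes the point after `x` positive as well.
...   | no a≯0 = a ∷ as , x , bs , refl , bs-above , λ z p →
  let p′ = subst Positive (sym (⊕-assoc z x _)) p
  in Positive-cancelʳ a≯0 p′ ∷ min (z ⊕ x) p′

-- Paths and walks as lists of steps

endpoint≡total : (v : Vec ℤ² n) → endpoint v ≡ total (toList v)
endpoint≡total []      = refl
endpoint≡total (x ∷ v) = cong (x ⊕_) (endpoint≡total v)

ListPath : Pred ℤ² 0ℓ → ℤ² → Pred (List ℤ²) 0ℓ
ListPath S z xs = All S xs × total xs ≡ z

PathTo⇒ListPath : {v : Vec ℤ² n} → PathTo S n z v → ListPath S z (toList v)
PathTo⇒ListPath {v = v} (v⊆S , end) = VecAll.toList⁺ v⊆S , trans (sym (endpoint≡total v)) end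

ListPath⇒PathTo : {v : Vec ℤ² n} → ListPath S z (toList v) → PathTo S n z v
ListPath⇒PathTo {v = v} (v⊆S , end) = VecAll.toList⁻ v⊆S , trans (endpoint≡total v) end

total-++-comm : ∀ xs ys → total (xs ++ ys) ≡ total (ys ++ xs)
total-++-comm xs ys = trans (total-++ xs ys) (trans (⊕-comm (total xs) _) (sym (total-++ ys xs)))

ListPath-++-comm : ∀ xs → ListPath S z (xs ++ ys) → ListPath S z (ys ++ xs)
ListPath-++-comm {ys = ys} xs (⊆S , end) =
  All.++⁺ (All.++⁻ʳ xs ⊆S) (All.++⁻ˡ xs ⊆S) , trans (total-++-comm ys xs) end

reaches : ∀ {a} → ListPath S (a , 0ℤ) xs → a ∈ ReachesAxisAt S
reaches {S = S} {xs = xs} path =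
  length xs , fromList xs ,
  ListPath⇒PathTo (subst (ListPath S _) (sym (Vec.toList∘fromList xs)) path)

-- The lower half plane together with the half line is exactly the complement of the positive cone.
-- This and its converse turn avoidance into `Above origin`.
Positive⇒allowed : Positive z → ¬ (proj₂ z < 0ℤ) × ¬ (z ∈ HalfLine)
Positive⇒allowed z>0 = ℤ.≤⇒≯ (Positive⇒height≥0 z>0) , not-half z>0
  where
  not-half : Positive z → ¬ (z ∈ HalfLine)
  not-half z>0 (zero  , refl) = <ʳ-irrefl z>0
  not-half z>0 (suc k , refl) with () ← positive-on-axis z>0

allowed⇒Positive : ¬ (proj₂ z < 0ℤ) → ¬ (z ∈ HalfLine) → Positive z
allowed⇒Positive {a , b} b≮0 z∉half with ℤ.<-cmp 0ℤ b
... | tri< 0<b _ _ = inj₁ 0<b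
... | tri> _ _ b<0 = contradiction b<0 b≮0
... | tri≈ _ refl _ with a
...   | + zero   = contradiction (0 , refl) z∉half
...   | + suc k  = inj₂ (refl , +<+ (ℕ.s≤s ℕ.z≤n))
...   | -[1+ k ] = contradiction (suc k , refl) z∉half

points⇒Above : ∀ z (v : Vec ℤ² n) → (∀ i → Positive (z ⊕ point v (suc i))) → Above z (toList v)
points⇒Above z []      h = []
points⇒Above z (x ∷ v) h =
  subst (λ u → Positive (z ⊕ u)) (⊕-identityʳ x) (h zero) ∷
  points⇒Above (z ⊕ x) v (λ i → subst Positive (sym (⊕-assoc z x _)) (h (suc i)))

Above⇒points : ∀ z (v : Vec ℤ² n) → Above z (toList v) → ∀ i → Positive (z ⊕ point v (suc i))
Above⇒points z (x ∷ v) (p ∷ _)  zero    = subst (λ u → Positive (z ⊕ u)) (sym (⊕-identityʳ x)) p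
Above⇒points z (x ∷ v) (_ ∷ ps) (suc i) = subst Positive (⊕-assoc z x _) (Above⇒points (z ⊕ x) v ps i)

Avoiding⇒Above : (v : Vec ℤ² n) → Avoiding v → Above origin (toList v)
Avoiding⇒Above v (heights , half) = points⇒Above origin v λ i →
  subst Positive (sym (⊕-identityˡ _)) (allowed⇒Positive (heights (suc i)) (half i))

Above⇒Avoiding : (v : Vec ℤ² n) → Above origin (toList v) → Avoiding v
Above⇒Avoiding {n} v above = heights , λ i → proj₂ (allowed i)
  where
  allowed : ∀ i → ¬ (proj₂ (point v (suc i)) < 0ℤ) × ¬ (point v (suc i) ∈ HalfLine)
  allowed i = Positive⇒allowed (subst Positive (⊕-identityˡ _) (Above⇒points origin v above i))

  heights : (i : Fin (suc n)) → ¬ (proj₂ (point v i) < 0ℤ)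
  heights zero    = ℤ.<-irrefl refl
  heights (suc i) = proj₁ (allowed i)

Avoiding⇒Positive-prefix : ∀ (v : Vec ℤ² n) x xs {ys} → toList v ≡ x ∷ xs ++ ys →
  Avoiding v → Positive (total (x ∷ xs))
Avoiding⇒Positive-prefix v x xs eq av = subst Positive (⊕-identityˡ _)
  (Above⇒Positive-total xs (subst (Above origin) eq (Avoiding⇒Above v av)))

-- Rotations

rotate₁ : Vec A n → Vec A n
rotate₁ []      = []
rotate₁ (x ∷ v) = v ∷ʳ x

rotate : ℕ → Vec A n → Vec A n
rotate zero    v = v
rotate (suc k) v = rotate k (rotate₁ v)

toList-injective : {v w : Vec A n} → toList v ≡ toList w → v ≡ w
toList-injective {v = v} {w} eq =
  trans (sym (Vec.cast-is-id refl v)) (Vec.toList-injective refl v w eq)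

toList-rotate : ∀ as {bs} (v : Vec A n) →
  toList v ≡ as ++ bs → toList (rotate (length as) v) ≡ bs ++ as
toList-rotate []       v       eq = trans eq (sym (List.++-identityʳ _))
toList-rotate (a ∷ as) {bs} (x ∷ v) eq with refl ← List.∷-injectiveˡ eq =
  trans (toList-rotate as (v ∷ʳ x) rotated) (List.++-assoc bs List.[ x ] as)
  where
  rotated : toList (v ∷ʳ x) ≡ as ++ bs ++ List.[ x ]
  rotated = trans (Vec.toList-∷ʳ x v)
    (trans (cong (_++ List.[ x ]) (List.∷-injectiveʳ eq)) (List.++-assoc as bs List.[ x ]))

rotate₁-injective : {v w : Vec A n} → rotate₁ v ≡ rotate₁ w → v ≡ w
rotate₁-injective {v = []}    {[]}    _  = refl
rotate₁-injective {v = x ∷ v} {y ∷ w} eq with refl , refl ← Vec.∷ʳ-injective v w eq = refl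

rotate-injective : ∀ k {v w : Vec A n} → rotate k v ≡ rotate k w → v ≡ w
rotate-injective zero    eq = eq
rotate-injective (suc k) eq = rotate₁-injective (rotate-injective k eq)

rotate-+ : ∀ k i (v : Vec A n) → rotate (k ℕ.+ i) v ≡ rotate i (rotate k v)
rotate-+ zero    i v = refl
rotate-+ (suc k) i v = rotate-+ k i (rotate₁ v)

rotate-cancel : ∀ i k {v w : Vec A n} → rotate i v ≡ rotate (i ℕ.+ k) w → v ≡ rotate k w
rotate-cancel i k {w = w} eq = rotate-injective i
  (trans eq (trans (cong (λ m → rotate m w) (ℕ.+-comm i k)) (rotate-+ k i w)))

split-at : ∀ {k} (xs : List A) → k ℕ.< length xs →
  ∃[ as ] ∃[ b ] ∃[ bs ] xs ≡ as ++ b ∷ bs × length as ≡ k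
split-at {k = zero}  (x ∷ xs) _           = [] , x , xs , refl , refl
split-at {k = suc k} (x ∷ xs) (ℕ.s≤s k<n) with split-at xs k<n
... | as , b , bs , refl , refl = x ∷ as , b , bs , refl , refl

private
  cartesianProduct-length : (xs : List A) (ys : List B) →
    length (cartesianProduct xs ys) ≡ length xs ℕ.* length ys
  cartesianProduct-length []       ys = refl
  cartesianProduct-length (x ∷ xs) ys = trans (List.length-++ (map (x ,_) ys))
    (cong₂ ℕ._+_ (List.length-map (x ,_) ys) (cartesianProduct-length xs ys))

-- Meant for rotation, which is injective on walks paired with amounts below `n`, but not on
-- arbitrary pairs.
map-unique : (f : A → B) {P : Pred A 0ℓ} → (∀ {x y} → P x → P y → f x ≡ f y → x ≡ y) →
  ∀ {xs} → All P xs → Unique xs → Unique (map f xs)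
map-unique f inj []         []               = []
map-unique f inj (px ∷ pxs) (x∉xs ∷ xs-uniq) =
  All.map⁺ (All.zipWith (λ (py , x≢y) fx≡fy → x≢y (inj px py fx≡fy)) (pxs , x∉xs)) ∷
  map-unique f inj pxs xs-uniq

-- The cycle lemma: paths as rotated walks.

module _ {p : ℤ} (least : IsSmallestPositive (ReachesAxisAt S) p) where

  private
    0<p : 0ℤ < p
    0<p = proj₁ least

    p>0 : Positive (p , 0ℤ)
    p>0 = inj₂ (refl , 0<p)

    p≤reached : ∀ {a} → 0ℤ < a → ListPath S (a , 0ℤ) xs → p ≤ a
    p≤reached 0<a path = proj₂ (proj₂ least) _ 0<a (reaches path)

  -- Positive points have nonnegative heights, and here these add up to zero, so both totals lie on
  -- the axis. Their abscissas are positive with sum `p`, which puts the end of `xs` strictly before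
  -- `p`.
  no-two-positive-pieces : ∀ xs ys → ListPath S (p , 0ℤ) (xs ++ ys) →
    Positive (total xs) → ¬ Positive (total ys)
  no-two-positive-pieces xs ys (⊆S , end) = go
    where
    sum : total xs ⊕ total ys ≡ (p , 0ℤ)
    sum = trans (sym (total-++ xs ys)) end

    go : Positive (total xs) → ¬ Positive (total ys)
    go (inj₁ 0<b) ys>0 =
      ℤ.<-irrefl (sym (cong proj₂ sum)) (ℤ.+-mono-<-≤ 0<b (Positive⇒height≥0 ys>0))
    go xs>0@(inj₂ _) (inj₁ 0<d) =
      ℤ.<-irrefl (sym (cong proj₂ sum)) (ℤ.+-mono-≤-< (Positive⇒height≥0 xs>0) 0<d)
    go (inj₂ (0≡b , 0<a)) (inj₂ (_ , 0<c)) = ℤ.<⇒≱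
      (subst₂ _<_ (ℤ.+-identityʳ (proj₁ (total xs))) (cong proj₁ sum)
        (ℤ.+-monoʳ-< (proj₁ (total xs)) 0<c))
      (p≤reached 0<a (All.++⁻ˡ xs ⊆S , cong (proj₁ (total xs) ,_) (sym 0≡b)))

  Walk : (n : ℕ) → Pred (Vec ℤ² n) 0ℓ
  Walk n = WalkTo S n (p , 0ℤ)

  Path : (n : ℕ) → Pred (Vec ℤ² n) 0ℓ
  Path n = PathTo S n (p , 0ℤ)

  -- A nonzero rotation by less than `n` cuts the path into two nonempty pieces. The first begins
  -- the walk `v` and the second begins its rotation, so both would have positive totals.
  walk-rotation-trivial : (v : Vec ℤ² n) → ∀ k → k ℕ.< n →
    Walk n v → Walk n (rotate k v) → k ≡ 0
  walk-rotation-trivial v zero    _   _            _        = refl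
  walk-rotation-trivial v (suc k) k<n (path , av) (_ , av′)
    with split-at (toList v) (subst (suc k ℕ.<_) (sym (Vec.length-toList v)) k<n)
  ... | a ∷ as , b , bs , eq , refl = contradiction
    (Avoiding⇒Positive-prefix (rotate (suc k) v) b bs (toList-rotate (a ∷ as) v eq) av′)
    (no-two-positive-pieces (a ∷ as) (b ∷ bs) (subst (ListPath S _) eq (PathTo⇒ListPath path))
      (Avoiding⇒Positive-prefix v a as eq av))

  -- Cancelling `i` rotations exhibits `u` as a rotation of `v` by the difference of `j` and `i`.
  -- Both being walks, the difference is zero.
  rotation-unique : ∀ {i j} {u v : Vec ℤ² n} → i ℕ.≤ j → j ℕ.< n → Walk n u → Walk n v →
    rotate i u ≡ rotate j v → u ≡ v × i ≡ j
  rotation-unique {i = i} {v = v} i≤j j<n u-walk v-walk eq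
    with k , refl ← ℕ.m≤n⇒∃[o]m+o≡n i≤j
    with refl ← rotate-cancel i k eq
    with refl ← walk-rotation-trivial v k (ℕ.≤-<-trans (ℕ.m≤n+m k i) j<n) v-walk u-walk
    = refl , sym (ℕ.+-identityʳ i)

  rotation-injective : ∀ {i j} {u v : Vec ℤ² n} → Walk n u × i ℕ.< n → Walk n v × j ℕ.< n →
    rotate i u ≡ rotate j v → (u , i) ≡ (v , j)
  rotation-injective {i = i} {j} (u-walk , i<n) (v-walk , j<n) eq with ℕ.≤-total i j
  ... | inj₁ i≤j with refl , refl ← rotation-unique i≤j j<n u-walk v-walk eq       = refl
  ... | inj₂ j≤i with refl , refl ← rotation-unique j≤i i<n v-walk u-walk (sym eq) = refl

  path-is-rotated-walk : (v : Vec ℤ² n) → Path n v →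
    ∃[ u ] ∃[ k ] Walk n u × k ℕ.< n × v ≡ rotate k u
  path-is-rotated-walk []      (_ , end) = contradiction (cong proj₁ end) (ℤ.<⇒≢ 0<p)
  path-is-rotated-walk (x ∷ v) path with cut-at-last-minimum x (toList v)
  ... | as , a , bs , eq , bs-above , min =
    -- `u` starts after the last minimum, which exchanges the two pieces; rotating by the length of
    -- `bs` exchanges them back.
    u , length bs , (ListPath⇒PathTo u-path , Above⇒Avoiding u u-above) , k<n , v-rotated
    where
    u : Vec ℤ² _
    u = rotate (suc (length as)) (x ∷ v)

    u-list : toList u ≡ bs ++ a ∷ as
    u-list = toList-rotate (a ∷ as) (x ∷ v) eq

    cut-path : ListPath S (p , 0ℤ) (bs ++ a ∷ as)
    cut-path = ListPath-++-comm (a ∷ as) (subst (ListPath S _) eq (PathTo⇒ListPath path))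

    u-path : ListPath S (p , 0ℤ) (toList u)
    u-path = subst (ListPath S _) (sym u-list) cut-path

    end>0 : Positive (origin ⊕ total bs ⊕ total (a ∷ as))
    end>0 = subst Positive (sym (trans (cong (_⊕ total (a ∷ as)) (⊕-identityˡ (total bs)))
      (trans (sym (total-++ bs (a ∷ as))) (proj₂ cut-path)))) p>0

    -- The points of `bs` are positive because the cut is at the last minimum. The other piece now
    -- ends at `(p , 0ℤ)`, and its end is a lowest of its points, so these are positive too.
    u-above : Above origin (toList u)
    u-above = subst (Above origin) (sym u-list) (Above-++ bs-above (min _ end>0))

    -- Strict because the first piece contains at least `a`.
    k<n : length bs ℕ.< suc _
    k<n = ℕ.s≤s (subst (length bs ℕ.≤_)
      (trans (sym (List.length-++ as))
        (trans (cong (pred ∘ length) (sym eq)) (Vec.length-toList v)))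
      (ℕ.m≤n+m (length bs) (length as)))

    v-rotated : x ∷ v ≡ rotate (length bs) u
    v-rotated = toList-injective (trans eq (sym (toList-rotate bs u u-list)))

  PathTo-rotate : ∀ k (v : Vec ℤ² n) → Path n v → Path n (rotate k v)
  PathTo-rotate zero    v       path = path
  PathTo-rotate (suc k) []      path = PathTo-rotate k [] path
  PathTo-rotate (suc k) (x ∷ v) path = PathTo-rotate k (v ∷ʳ x) (ListPath⇒PathTo
    (subst (ListPath S _) (sym (Vec.toList-∷ʳ x v)) (ListPath-++-comm List.[ x ] (PathTo⇒ListPath path))))

  -- Rotation maps the pairs of a walk and an amount below `n` bijectively onto the paths.
  -- Finiteness thus has to be shown for the walks only.
  PathTo-cardinality : ∀ {m} → HasCardinality (Walk n) m → HasCardinality (Path n) (m ℕ.* n)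
  PathTo-cardinality {n} (ws , ws-uniq , ws⇔ , refl) =
    map rot pairs ,
    map-unique rot rotation-injective
      (All.tabulate walk-pair) (Unique.cartesianProduct⁺ ws-uniq (Unique.upTo⁺ n)) ,
    (λ v → mk⇔ to from) ,
    trans (List.length-map rot pairs)
      (trans (cartesianProduct-length ws (upTo n)) (cong (length ws ℕ.*_) (List.length-upTo n)))
    where
    rot : Vec ℤ² n × ℕ → Vec ℤ² n
    rot (u , k) = rotate k u

    pairs : List (Vec ℤ² n × ℕ)
    pairs = cartesianProduct ws (upTo n)

    walk-pair : ∀ {uk} → uk List.∈ pairs → Walk n (proj₁ uk) × proj₂ uk ℕ.< n
    walk-pair uk∈ with u∈ , k∈ ← ∈-cartesianProduct⁻ ws (upTo n) uk∈ =
      Equivalence.to (ws⇔ _) u∈ , ∈-upTo⁻ k∈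

    to : ∀ {v} → v List.∈ map rot pairs → Path n v
    to v∈ with (u , k) , uk∈ , refl ← ∈-map⁻ rot v∈ =
      PathTo-rotate k u (proj₁ (proj₁ (walk-pair uk∈)))

    from : ∀ {v} → Path n v → v List.∈ map rot pairs
    from {v} path with u , k , u-walk , k<n , refl ← path-is-rotated-walk v path =
      ∈-map⁺ rot (∈-cartesianProduct⁺ (Equivalence.from (ws⇔ u) u-walk) (∈-upTo⁺ k<n))

-- Finiteness

-- The subset `P` always contains the larger element `y`, and contains `x` exactly when `Q` holds,
-- so its least element reveals whether `Q` holds.
distinct⇒excluded-middle : WellOrdered S → x ∈ S → y ∈ S → x <ʳ y → ExcludedMiddle 0ℓ
distinct⇒excluded-middle {S} {x} {y} wo x∈S y∈S x<y {Q} =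
  decide (wo P P⊆S (y , inj₁ refl))
  where
  P : Pred ℤ² 0ℓ
  P z = z ≡ y ⊎ (z ≡ x × Q)

  P⊆S : ∀ {z} → z ∈ P → z ∈ S
  P⊆S (inj₁ refl)       = y∈S
  P⊆S (inj₂ (refl , _)) = x∈S

  decide : ∃[ m ] (m ∈ P × (∀ z → z ∈ P → m ≤ʳ z)) → Dec Q
  decide (_ , inj₁ refl , min)    = no λ q → <ʳ-irrefl (<ʳ-≤ʳ-trans x<y (min x (inj₂ (refl , q))))
  decide (_ , inj₂ (_ , q) , min) = yes q

finite-cover⇒cardinality : ExcludedMiddle 0ℓ → Decidable (_≡_ {A = A}) →
  (P : Pred A 0ℓ) (cover : List A) → (∀ {x} → P x → x List.∈ cover) → ∃[ m ] HasCardinality P m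
finite-cover⇒cardinality em _≟_ P cover covers =
  _ , filter P? candidates ,
  Unique.filter⁺ P? (deduplicate-! _≟_ cover) ,
  (λ x → mk⇔ (λ x∈ → proj₂ (∈-filter⁻ P? {xs = candidates} x∈))
             (λ px → ∈-filter⁺ P? {xs = candidates} (∈-deduplicate⁺ _≟_ (covers px)) px)) ,
  refl
  where
  candidates : List _
  candidates = deduplicate _≟_ cover

  P? : ∀ x → Dec (P x)
  P? x = em

range : ℤ → ℤ → List ℤ
range l u = map (λ k → l + + k) (upTo (suc ∣ u - l ∣))

l+∣a-l∣≡a : ∀ {l a} → l ≤ a → l + + ∣ a - l ∣ ≡ a
l+∣a-l∣≡a {l} {a} l≤a = begin
  l + + ∣ a - l ∣  ≡⟨ cong (λ i → l + i) (ℤ.0≤i⇒+∣i∣≡i (ℤ.i≤j⇒0≤j-i l≤a)) ⟩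
  l + (a - l)      ≡⟨ cong (λ i → l + i) (ℤ.+-comm a (- l)) ⟩
  l + (- l + a)    ≡⟨ ℤ.+-assoc l (- l) a ⟨
  (l - l) + a      ≡⟨ cong (λ i → i + a) (ℤ.+-inverseʳ l) ⟩
  0ℤ + a           ≡⟨ ℤ.+-identityˡ a ⟩
  a                ∎
  where open ≡-Reasoning

∣a-l∣≤∣u-l∣ : ∀ {l a u} → l ≤ a → a ≤ u → ∣ a - l ∣ ℕ.≤ ∣ u - l ∣
∣a-l∣≤∣u-l∣ {l} l≤a a≤u = ℤ.drop‿+≤+ (subst₂ _≤_
  (sym (ℤ.0≤i⇒+∣i∣≡i (ℤ.i≤j⇒0≤j-i l≤a)))
  (sym (ℤ.0≤i⇒+∣i∣≡i (ℤ.i≤j⇒0≤j-i (ℤ.≤-trans l≤a a≤u))))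
  (ℤ.+-monoˡ-≤ (- l) a≤u))

∈-range : ∀ {l a u} → l ≤ a → a ≤ u → a List.∈ range l u
∈-range {l} {u = u} l≤a a≤u = subst (List._∈ range l u) (l+∣a-l∣≡a l≤a)
  (∈-map⁺ (λ k → l + + k) (∈-upTo⁺ (ℕ.s≤s (∣a-l∣≤∣u-l∣ l≤a a≤u))))

vectors : List A → ∀ n → List (Vec A n)
vectors xs zero    = [] ∷ []
vectors xs (suc n) = cartesianProductWith _∷_ xs (vectors xs n)

∈-vectors : {xs : List A} (v : Vec A n) → All (List._∈ xs) (toList v) → v List.∈ vectors xs n
∈-vectors []      []           = here refl
∈-vectors (x ∷ v) (x∈xs ∷ v⊆xs) = ∈-cartesianProductWith⁺ _∷_ x∈xs (∈-vectors v v⊆xs)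

-- Bounding one step by the sum of all.

module _ (π : ℤ² → ℤ) (π-origin : π origin ≡ 0ℤ) (π-⊕ : ∀ x y → π (x ⊕ y) ≡ π x + π y)
         (l : ℤ) where

  open ℤ.≤-Reasoning

  length*l≤total : All (λ s → l ≤ π s) xs → + length xs ℤ.* l ≤ π (total xs)
  length*l≤total []                        = ℤ.≤-reflexive (trans (ℤ.*-zeroˡ l) (sym π-origin))
  length*l≤total {x ∷ xs} (l≤x ∷ l≤xs) = begin
    + suc (length xs) ℤ.* l  ≡⟨ ℤ.suc-* (+ length xs) l ⟩
    l + + length xs ℤ.* l    ≤⟨ ℤ.+-mono-≤ l≤x (length*l≤total l≤xs) ⟩
    π x + π (total xs)       ≡⟨ π-⊕ x (total xs) ⟨
    π (x ⊕ total xs)         ∎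

  -- Besides the chosen step there are `pred (length xs)` others, each contributing at least `l`.
  step+rest≤total : All (λ s → l ≤ π s) xs → x List.∈ xs →
    π x + + pred (length xs) ℤ.* l ≤ π (total xs)
  step+rest≤total {x ∷ xs} (_ ∷ l≤xs) (here refl) = begin
    π x + + length xs ℤ.* l  ≤⟨ ℤ.+-monoʳ-≤ (π x) (length*l≤total l≤xs) ⟩
    π x + π (total xs)       ≡⟨ π-⊕ x (total xs) ⟨
    π (x ⊕ total xs)         ∎
  -- Membership forces the tail to be nonempty; matching on it exposes a successor, so that one copy
  -- of `l` can be charged to `y`.
  step+rest≤total {y ∷ xs@(_ ∷ zs)} {x} (l≤y ∷ l≤xs) (there x∈xs) = begin
    π x + + suc (length zs) ℤ.* l    ≡⟨ cong (λ r → π x + r) (ℤ.suc-* (+ length zs) l) ⟩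
    π x + (l + r)                    ≡⟨ ℤ.+-assoc (π x) l r ⟨
    (π x + l) + r                    ≡⟨ cong (λ i → i + r) (ℤ.+-comm (π x) l) ⟩
    (l + π x) + r                    ≡⟨ ℤ.+-assoc l (π x) r ⟩
    l + (π x + r)                    ≤⟨ ℤ.+-mono-≤ l≤y (step+rest≤total l≤xs x∈xs) ⟩
    π y + π (total xs)               ≡⟨ π-⊕ y (total xs) ⟨
    π (y ⊕ total xs)                 ∎
    where
    r : ℤ
    r = + length zs ℤ.* l

  -- What is left of the total `t` for one step when the other steps contribute as little as
  -- possible.
  step-bound : ℕ → ℤ → ℤ
  step-bound n t = t - + pred n ℤ.* l

  step≤bound : ∀ {t} → length xs ≡ n → π (total xs) ≡ t → All (λ s → l ≤ π s) xs →
    x List.∈ xs → π x ≤ step-bound n t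
  step≤bound {xs} {x = x} refl refl l≤xs x∈xs = begin
    π x                ≡⟨ ℤ.+-identityʳ (π x) ⟨
    π x + 0ℤ           ≡⟨ cong (λ i → π x + i) (ℤ.+-inverseʳ r) ⟨
    π x + (r - r)      ≡⟨ ℤ.+-assoc (π x) r (- r) ⟨
    (π x + r) - r      ≤⟨ ℤ.+-monoˡ-≤ (- r) (step+rest≤total l≤xs x∈xs) ⟩
    π (total xs) - r   ∎
    where
    r : ℤ
    r = + pred (length xs) ℤ.* l

-- Confining the steps to a finite box.

module _ (em : ExcludedMiddle 0ℓ) (wo : WellOrdered S)
         {least : ℤ²} (least≤ : ∀ s → s ∈ S → least ≤ʳ s) where

  private
    h : ℤ
    h = proj₂ least

  height≥ : ∀ {s} → s ∈ S → h ≤ proj₂ s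
  height≥ {s} s∈S with least≤ s s∈S
  ... | inj₁ (inj₁ h<b)       = ℤ.<⇒≤ h<b
  ... | inj₁ (inj₂ (h≡b , _)) = ℤ.≤-reflexive h≡b
  ... | inj₂ refl             = ℤ.≤-refl

  row-bounded : ∀ b → ∃[ l ] (∀ a → (a , b) ∈ S → l ≤ a)
  row-bounded b with em {∃[ a ] (a , b) ∈ S}
  -- Any number bounds an empty row; `0ℤ` is a placeholder.
  ... | no empty      = 0ℤ , λ a s → contradiction (a , s) empty
  ... | yes (a₀ , s₀) with wo (λ z → z ∈ S × proj₂ z ≡ b) proj₁ ((a₀ , b) , s₀ , refl)
  ...   | (l , _) , (_ , refl) , min = l , λ a s → leftmost (min (a , b) (s , refl))
    where
    leftmost : ∀ {a} → (l , b) ≤ʳ (a , b) → l ≤ a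
    leftmost (inj₁ (inj₁ b<b))       = contradiction b<b (ℤ.<-irrefl refl)
    leftmost (inj₁ (inj₂ (_ , l<a))) = ℤ.<⇒≤ l<a
    leftmost (inj₂ refl)             = ℤ.≤-refl

  -- Higher rows may extend ever further to the left, so a common bound is sought only for finitely
  -- many rows, numbered by their height above `h`.
  rows-bounded : ∀ N → ∃[ l ] (∀ a k → k ℕ.< N → (a , h + + k) ∈ S → l ≤ a)
  rows-bounded zero    = 0ℤ , λ _ _ ()
  rows-bounded (suc N) with rows-bounded N | row-bounded (h + + N)
  ... | l , l≤ | m , m≤ = l ℤ.⊓ m , bound
    where
    bound : ∀ a k → k ℕ.< suc N → (a , h + + k) ∈ S → l ℤ.⊓ m ≤ a
    bound a k k<1+N s with ℕ.m<1+n⇒m<n∨m≡n k<1+N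
    ... | inj₁ k<N  = ℤ.≤-trans (ℤ.i⊓j≤i l m) (l≤ a k k<N s)
    ... | inj₂ refl = ℤ.≤-trans (ℤ.i⊓j≤j l m) (m≤ a s)

  module _ (n : ℕ) (z : ℤ²) where

    private
      top : ℤ
      top = step-bound proj₂ refl (λ _ _ → refl) h n (proj₂ z)

      l : ℤ
      -- The successor includes the row at height `top` itself.
      l = proj₁ (rows-bounded (suc ∣ top - h ∣))

      right : ℤ
      right = step-bound proj₁ refl (λ _ _ → refl) l n (proj₁ z)

    box : List ℤ²
    box = cartesianProduct (range l right) (range h top)

    -- The bounds build on each other: `h` and the total height give `top`, the finitely many rows
    -- up to `top` give `l`, and `l` with the total abscissa gives `right`.
    steps-in-box : length xs ≡ n → ListPath S z xs → All (List._∈ box) xs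
    steps-in-box {xs} len (⊆S , end) = All.tabulate λ s∈xs →
      ∈-cartesianProduct⁺ (∈-range (l≤ s∈xs) (≤right s∈xs))
                          (∈-range (height≥ (All.lookup ⊆S s∈xs)) (≤top s∈xs))
      where
      ≤top : ∀ {s} → s List.∈ xs → proj₂ s ≤ top
      ≤top = step≤bound proj₂ refl (λ _ _ → refl) h len (cong proj₂ end) (All.map height≥ ⊆S)

      l≤ : ∀ {s} → s List.∈ xs → l ≤ proj₁ s
      l≤ {a , b} s∈xs = proj₂ (rows-bounded (suc ∣ top - h ∣)) a ∣ b - h ∣
        (ℕ.s≤s (∣a-l∣≤∣u-l∣ (height≥ s∈S) (≤top s∈xs)))
        (subst (λ b → (a , b) ∈ S) (sym (l+∣a-l∣≡a (height≥ s∈S))) s∈S)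
        where
        s∈S : (a , b) ∈ S
        s∈S = All.lookup ⊆S s∈xs

      ≤right : ∀ {s} → s List.∈ xs → proj₁ s ≤ right
      ≤right = step≤bound proj₁ refl (λ _ _ → refl) l len (cong proj₁ end) (All.tabulate l≤)

    WalkTo-finite : ∃[ m ] HasCardinality (WalkTo S n z) m
    WalkTo-finite = finite-cover⇒cardinality em (Vec.≡-dec (≡-dec ℤ._≟_ ℤ._≟_))
      (WalkTo S n z) (vectors box n) λ {v} (path , _) →
        ∈-vectors v (steps-in-box (Vec.length-toList v) (PathTo⇒ListPath path))

-- A non-positive first step can be cancelled, leaving a positive sum to search. If the least
-- element of `S` is not positive, the step found is a second element.
positive-step : ∀ xs → Positive (total xs) → ∃[ s ] s List.∈ xs × Positive s
positive-step []       p = contradiction p <ʳ-irrefl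
positive-step (x ∷ xs) p with positive? x
... | yes x>0 = x , here refl , x>0
... | no  x≯0 with positive-step xs (Positive-cancelʳ x≯0 (subst Positive (⊕-comm x _) p))
...   | s , s∈xs , s>0 = s , there s∈xs , s>0

module _ {p : ℤ} (least-p : IsSmallestPositive (ReachesAxisAt S) p) where

  private
    0<p : 0ℤ < p
    0<p = proj₁ least-p

    p>0 : Positive (p , 0ℤ)
    p>0 = inj₂ (refl , 0<p)

    some-path : ∃[ xs ] ListPath S (p , 0ℤ) xs
    some-path with _ , v , path ← proj₁ (proj₂ least-p) = toList v , PathTo⇒ListPath path

  -- The case of a positive least step.

  module _ {least : ℤ²} (least∈S : least ∈ S) (least≤ : ∀ s → s ∈ S → least ≤ʳ s)
           (least>0 : Positive least) where

    private
      S-positive : ∀ {s} → s ∈ S → Positive s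
      S-positive s∈S = <ʳ-≤ʳ-trans least>0 (least≤ _ s∈S)

    -- On a path to `(p , 0ℤ)` the first step is at least `least`, and the later steps, all
    -- positive, only increase the sum.
    least≤ʳp : least ≤ʳ (p , 0ℤ)
    least≤ʳp with some-path
    ... | []     , _ , end = contradiction (cong proj₁ end) (ℤ.<⇒≢ 0<p)
    ... | x ∷ xs , (x∈S ∷ xs⊆S) , end = ≤ʳ-trans (least≤ x x∈S)
      (subst (x ≤ʳ_) end (≤ʳ-⊕-total (All.map S-positive xs⊆S) x))

    -- Were `least` smaller, positivity would put it on the axis, and as a one-step path it would
    -- contradict the choice of `p`.
    least≡p : least ≡ (p , 0ℤ)
    least≡p with least≤ʳp
    ... | inj₂ eq                  = eq
    ... | inj₁ (inj₁ b<0)          = contradiction (Positive⇒height≥0 least>0) (ℤ.<⇒≱ b<0)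
    ... | inj₁ (inj₂ (refl , a<p)) = contradiction
      (proj₂ (proj₂ least-p) _ (positive-on-axis least>0)
        (reaches (least∈S ∷ [] , ⊕-identityʳ least)))
      (ℤ.<⇒≱ a<p)

    -- `S` may have a single element here, which gives no access to excluded middle, so the walks
    -- are listed explicitly.
    WalkTo-finite-positive : ∀ n → ∃[ m ] HasCardinality (WalkTo S (suc n) (p , 0ℤ)) m
    WalkTo-finite-positive zero =
      1 , ((p , 0ℤ) ∷ []) ∷ [] , [] ∷ [] , (λ v → mk⇔ to from) , refl
      where
      to : ∀ {v} → v List.∈ ((p , 0ℤ) ∷ []) ∷ [] → WalkTo S 1 (p , 0ℤ) v
      to (here refl) =
        ListPath⇒PathTo (subst (_∈ S) least≡p least∈S ∷ [] , ⊕-identityʳ (p , 0ℤ)) ,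
        Above⇒Avoiding ((p , 0ℤ) ∷ []) (subst Positive (sym (⊕-identityˡ (p , 0ℤ))) p>0 ∷ [])

      from : ∀ {v} → WalkTo S 1 (p , 0ℤ) v → v List.∈ ((p , 0ℤ) ∷ []) ∷ []
      from {s ∷ []} ((_ , end) , _) = here (cong (_∷ []) (trans (sym (⊕-identityʳ s)) end))
    WalkTo-finite-positive (suc n) =
      0 , [] , [] , (λ v → mk⇔ (λ ()) (λ walk → contradiction walk (no-walk v))) , refl
      where
      no-walk : ∀ v → ¬ WalkTo S (suc (suc n)) (p , 0ℤ) v
      no-walk (s ∷ t ∷ v) (path , _) with s∈S ∷ t∈S ∷ v⊆S , end ← PathTo⇒ListPath path =
        -- The first step is already at least `(p , 0ℤ)`, and the remaining ones increase the sum
        -- strictly.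
        <ʳ-irrefl (≤ʳ-<ʳ-trans (subst (_≤ʳ s) least≡p (least≤ s s∈S))
          (subst (s <ʳ_) end (<ʳ-⊕ s
            (<ʳ-≤ʳ-trans (S-positive t∈S) (≤ʳ-⊕-total (All.map S-positive v⊆S) t)))))

  -- The path to `(p , 0ℤ)` shows that `S` is inhabited, hence has a least element, whose sign is
  -- decidable outright. If it is not positive, it differs from the positive step `s`, and the two
  -- yield excluded middle.
  WalkTo-cardinality : WellOrdered S → ∀ n → ∃[ m ] HasCardinality (WalkTo S (suc n) (p , 0ℤ)) m
  WalkTo-cardinality wo n
    with xs , xs⊆S , end ← some-path
    with s , s∈xs , s>0 ← positive-step xs (subst Positive (sym end) p>0)
    with s∈S ← All.lookup xs⊆S s∈xs
    with least , least∈S , least≤ ← wo S (λ t∈S → t∈S) (s , s∈S)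
    with positive? least
  ... | yes least>0 = WalkTo-finite-positive least∈S least≤ least>0 n
  ... | no  least≯0 with least≤ s s∈S
  ...   | inj₂ refl    = contradiction s>0 least≯0
  ...   | inj₁ least<s = WalkTo-finite
    (λ {Q} → distinct⇒excluded-middle wo least∈S s∈S least<s {Q}) wo least≤ (suc n) (p , 0ℤ)

-- `_/_` reduces fractions to lowest terms, so the identity is checked by cross multiplication in
-- the unnormalised rationals.
w≡1/n*wn : ∀ w k → (+ w / 1) ≡ (+ 1 / suc k) * (+ (w ℕ.* suc k) / 1)
w≡1/n*wn w k = ℚ.toℚᵘ-injective (begin
  toℚᵘ (+ w / 1)
    ≈⟨ ℚ.toℚᵘ-fromℚᵘ (ℚᵘ.mkℚᵘ (+ w) 0) ⟩
  ℚᵘ.mkℚᵘ (+ w) 0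
    ≈⟨ ℚᵘ.*≡* cross ⟩
  ℚᵘ.mkℚᵘ (+ 1) k ℚᵘ.* ℚᵘ.mkℚᵘ (+ (w ℕ.* suc k)) 0
    ≈⟨ ℚᵘ.*-cong (ℚ.toℚᵘ-fromℚᵘ (ℚᵘ.mkℚᵘ (+ 1) k))
                 (ℚ.toℚᵘ-fromℚᵘ (ℚᵘ.mkℚᵘ (+ (w ℕ.* suc k)) 0)) ⟨
  toℚᵘ (+ 1 / suc k) ℚᵘ.* toℚᵘ (+ (w ℕ.* suc k) / 1)
    ≈⟨ ℚ.toℚᵘ-homo-* (+ 1 / suc k) (+ (w ℕ.* suc k) / 1) ⟨
  toℚᵘ ((+ 1 / suc k) * (+ (w ℕ.* suc k) / 1))
    ∎)
  where
  open ℚᵘ.≃-Reasoning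

  cross : + w ℤ.* + (suc k ℕ.* 1) ≡ (+ 1 ℤ.* + (w ℕ.* suc k)) ℤ.* + 1
  cross = trans (sym (ℤ.pos-* w (suc k ℕ.* 1)))
    (trans (cong (λ d → + (w ℕ.* d)) (ℕ.*-identityʳ (suc k)))
      (sym (trans (ℤ.*-identityʳ _) (ℤ.*-identityˡ _))))

mainTheorem6 : (S : Pred ℤ² 0ℓ) → WellOrdered S →
    (p : ℤ) → IsSmallestPositive (ReachesAxisAt S) p →
    (n : ℕ) → .{{_ : NonZero n}} →
    ∃[ w ] ∃[ m ]
    ( HasCardinality (WalkTo S n (p , 0ℤ)) w
    × HasCardinality (PathTo S n (p , 0ℤ)) m
    × (+ w / 1) ≡ (+ 1 / n) * (+ m / 1) )
mainTheorem6 S wo p least (suc n) with w , walks ← WalkTo-cardinality least wo n =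
  w , w ℕ.* suc n , walks , PathTo-cardinality least walks , w≡1/n*wn w n
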